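{- Let $G$ be a finite group, and let $A$ be a finite free $G$-set with at least two elements. Then the finitary double centralizer clone $(\Sigma^A)^{\perp\perp(\aleph_0)}$ of $A$ is equal to the clone of finitary derived operations $\langle \Sigma^A\rangle_{\aleph_0}$ of $A$, where $\Sigma$ is the signature consisting of a unary operation symbol $\gamma$ for each $\gamma\in G$.
   Context: A free $G$-set is a set $A$ with an associative and unital left action $G\times A\to A$, $(\gamma,a)\mapsto\gamma a$, such that for all $\gamma\in G$ and $a\in A$, if $\gamma a=a$ then $\gamma=1$. $\Sigma^A$ denotes the set of basic unary operations $a\mapsto\gamma a$ on $A$ $(\gamma\in G)$. A finitary operation on a set $A$ is a map $A^n\to A$ with $n$ a finite cardinal ($n=0$ is allowed). A finitary clone on $A$ is a set $F$ of finitary operations on $A$ that contains all projections $\pi_i:A^n\to A$ and is such that for every $f:A^m\to A$ in $F$ and all $g_1,\dots,g_m:A^n\to A$ in $F$, the composite $f\circ(g_1,\dots,g_m):A^n\to A$ lies in $F$. The clone of finitary derived operations $\langle\Sigma^A\rangle_{\aleph_0}$ is the smallest finitary clone on $A$ containing $\Sigma^A$. Operations $f:A^n\to A$ and $g:A^m\to A$ commute, written $f\perp g$, if for every matrix $a=(a_{ij})\in A^{n\times m}$ one has $g\bigl((f((a_{ij})_{i\in n}))_{j\in m}\bigr)=f\bigl((g((a_{ij})_{j\in m}))_{i\in n}\bigr)$. For a set $F$ of finitary operations on $A$, $F^{\perp(\aleph_0)}$ is the set of all finitary operations $f$ on $A$ with $f\perp g$ for all $g\in F$, and $F^{\perp\perp(\aleph_0)}$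 is the result of applying $(-)^{\perp(\aleph_0)}$ twice to $F$. -}

module Defs where

open import Algebra.Bundles using (Group)
open import Data.Fin.Base using (Fin)
open import Data.Nat.Base using (ℕ)
open import Data.Product.Base using (∃)
open import Data.Vec.Base using (Vec; []; _∷_; lookup; tabulate)
open import Function.Bundles using (Inverse)
open import Level using (Level; _⊔_; suc)
open import Relation.Binary.Bundles using (Setoid)
open import Relation.Binary.PropositionalEquality
  using (_≡_; _≗_; refl; setoid)
open import Relation.Unary using (Pred; _⊆_)

private
  variable
    a c ℓ ℓ′ : Level

Finite : Setoid c ℓ → Set (c ⊔ ℓ)
Finite S = ∃ λ (n : ℕ) → Inverse S (setoid (Fin n))

record FreeGSet (G : Group c ℓ) (a : Level) : Set (c ⊔ ℓ ⊔ suc a) where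
  private module G = Group G
  infixr 7 _·_
  field
    Carrier : Set a
    _·_     : G.Carrier → Carrier → Carrier
    ·-congʳ : ∀ {γ δ} x → γ G.≈ δ → γ · x ≡ δ · x
    ·-assoc : ∀ γ δ x → (γ G.∙ δ) · x ≡ γ · (δ · x)
    ·-unit  : ∀ x → G.ε · x ≡ x
    free    : ∀ γ x → γ · x ≡ x → γ G.≈ G.ε

-- A^n is Vec A n rather than Fin n → A, so that equality of argument tuples
-- is entrywise without function extensionality.
Op : Set a → ℕ → Set a
Op A n = Vec A n → A

OpSet : Set a → (ℓ : Level) → Set (a ⊔ suc ℓ)
OpSet A ℓ = ∀ n → Pred (Op A n) ℓ

module _ {A : Set a} where

  π : ∀ {n} → Fin n → Op A n
  π i x = lookup x i

  compose : ∀ {m n} → Op A m → (Fin m → Op A n) → Op A n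
  compose f g x = f (tabulate λ i → g i x)

  -- Equality of operations is pointwise equality _≗_, so a clone, as a set of
  -- operations, is required to be closed under it.
  record IsClone (F : OpSet A ℓ) : Set (a ⊔ ℓ) where
    field
      resp : ∀ {n} {f g : Op A n} → f ≗ g → F n f → F n g
      proj : ∀ {n} (i : Fin n) → F n (π i)
      comp : ∀ {m n} {f : Op A m} {g : Fin m → Op A n} →
             F m f → (∀ i → F n (g i)) → F n (compose f g)

  data ⟨_⟩ (F : OpSet A ℓ) : OpSet A (a ⊔ ℓ) where
    incl : ∀ {n} {f : Op A n} → F n f → ⟨ F ⟩ n f
    resp : ∀ {n} {f g : Op A n} → f ≗ g → ⟨ F ⟩ n f → ⟨ F ⟩ n g
    proj : ∀ {n} (i : Fin n) → ⟨ F ⟩ n (π i)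
    comp : ∀ {m n} {f : Op A m} {g : Fin m → Op A n} →
           ⟨ F ⟩ m f → (∀ i → ⟨ F ⟩ n (g i)) → ⟨ F ⟩ n (compose f g)

  -- Together with incl, the next two facts say that ⟨ F ⟩ is the smallest
  -- clone containing F.
  ⟨⟩-isClone : (F : OpSet A ℓ) → IsClone ⟨ F ⟩
  ⟨⟩-isClone F = record { resp = resp ; proj = proj ; comp = comp }

  ⟨⟩-least : {F : OpSet A ℓ} {H : OpSet A ℓ′} → IsClone H →
             (∀ n → F n ⊆ H n) → ∀ n → ⟨ F ⟩ n ⊆ H n
  ⟨⟩-least H-clone F⊆H n (incl p)    = F⊆H n p
  ⟨⟩-least H-clone F⊆H n (resp eq p) =
    IsClone.resp H-clone eq (⟨⟩-least H-clone F⊆H n p)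
  ⟨⟩-least H-clone F⊆H n (proj i)    = IsClone.proj H-clone i
  ⟨⟩-least H-clone F⊆H n (comp p q)  =
    IsClone.comp H-clone (⟨⟩-least H-clone F⊆H _ p)
                         (λ i → ⟨⟩-least H-clone F⊆H n (q i))

  infix 4 _⟂_
  _⟂_ : ∀ {n m} → Op A n → Op A m → Set a
  _⟂_ {n} {m} f g = (x : Fin n → Fin m → A) →
    g (tabulate λ j → f (tabulate λ i → x i j)) ≡
    f (tabulate λ i → g (tabulate λ j → x i j))

  infix 8 _^⟂ _^⟂⟂
  _^⟂ : OpSet A ℓ → OpSet A (a ⊔ ℓ)
  (F ^⟂) n f = ∀ m (g : Op A m) → F m g → f ⟂ g

  _^⟂⟂ : OpSet A ℓ → OpSet A (a ⊔ ℓ)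
  F ^⟂⟂ = (F ^⟂) ^⟂

-- The basic operations x ↦ γ x, up to pointwise equality.
module _ {G : Group c ℓ} (A : FreeGSet G a) where
  open FreeGSet A

  data BasicOp : OpSet Carrier (a ⊔ c) where
    basic : (γ : Group.Carrier G) {f : Op Carrier 1} →
            (∀ x → f (x ∷ []) ≡ γ · x) → BasicOp 1 f

{-# OPTIONS --safe #-}

-- Enumerate A^n by e : Fin m → A^n, and regard an n-ary operation f as its
-- value table in A^m.  The matrix whose columns are the e j has as rows the
-- tables of the projections, so an equivariant g : A^m → A commuting with f
-- satisfies g (table f) ≡ f (g (table π₁) , … , g (table πₙ)).  Since G acts
-- freely on A, the value of g on the orbit of table f can be prescribed
-- independently of its values elsewhere; if no table of a projection lay on that
-- orbit, the right-hand side would not depend on the prescribed value, which is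
-- absurd when A has two elements.  Hence f is γ πᵢ for some γ and i.
module Submission where

open import Defs
open import Algebra.Bundles using (Group)
open import Algebra.Properties.Group using (x∙y⁻¹≈ε⇒x≈y)
open import Data.Fin.Base using (Fin; zero; finToFun; funToFin)
open import Data.Fin.Properties using (any?; inj⇒≟; finToFun-funToFin)
open import Data.Nat.Base using (_^_)
open import Data.Product.Base using (∃; ∃₂; _,_; proj₁; proj₂)
open import Data.Vec.Base using (Vec; []; _∷_; head; lookup; map; replicate; tabulate)
open import Data.Vec.Properties
  using (≡-dec; lookup-map; lookup∘tabulate; map-cong; map-id; map-∘;
         tabulate-cong; tabulate-∘; tabulate∘lookup)
open import Function.Base using (_∘_)
open import Function.Bundles using (Inverse)
open import Function.Properties.Inverse using (Inverse⇒Injection)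
open import Level using (Level)
open import Relation.Binary.Definitions using (DecidableEquality)
open import Relation.Binary.PropositionalEquality
  using (_≡_; _≢_; _≗_; refl; sym; trans; cong; setoid; module ≡-Reasoning)
open import Relation.Nullary using (¬_; Dec; yes; no; contradiction)
open import Relation.Nullary.Decidable using (map′)
open import Relation.Unary using (_≐_)

open ≡-Reasoning

private
  variable
    a c ℓ : Level

-- Centralizer clones and the enumeration of tuples

module _ {A : Set a} where

  ⟂-sym : ∀ {n m} {f : Op A n} {g : Op A m} → f ⟂ g → g ⟂ f
  ⟂-sym f⟂g x = sym (f⟂g λ i j → x j i)

  ⊆-⟂⟂ : {F : OpSet A ℓ} → ∀ n {f : Op A n} → F n f → (F ^⟂⟂) n f
  ⊆-⟂⟂ n {f} f∈F m g g∈F⟂ = ⟂-sym {f = g} {g = f} (g∈F⟂ n f f∈F)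

  ⟂-respˡ : ∀ {n m} {f g : Op A n} {h : Op A m} → f ≗ g → f ⟂ h → g ⟂ h
  ⟂-respˡ {f = f} {g} {h} f≗g f⟂h x = begin
    h (tabulate λ j → g (tabulate λ i → x i j))
      ≡⟨ cong h (tabulate-cong λ j → f≗g _) ⟨
    h (tabulate λ j → f (tabulate λ i → x i j))
      ≡⟨ f⟂h x ⟩
    f (tabulate λ i → h (tabulate λ j → x i j))
      ≡⟨ f≗g _ ⟩
    g (tabulate λ i → h (tabulate λ j → x i j)) ∎

  π-⟂ : ∀ {n m} (i : Fin n) (h : Op A m) → π i ⟂ h
  π-⟂ i h x = begin
    h (tabulate λ j → lookup (tabulate λ k → x k j) i)
      ≡⟨ cong h (tabulate-cong λ j → lookup∘tabulate (λ k → x k j) i) ⟩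
    h (tabulate λ j → x i j)
      ≡⟨ lookup∘tabulate (λ k → h (tabulate (x k))) i ⟨
    lookup (tabulate λ k → h (tabulate λ j → x k j)) i ∎

  compose-⟂ : ∀ {m n k} {f : Op A m} {g : Fin m → Op A n} {h : Op A k} →
              f ⟂ h → (∀ i → g i ⟂ h) → compose f g ⟂ h
  compose-⟂ {f = f} {g} {h} f⟂h g⟂h x = begin
    h (tabulate λ j → f (tabulate λ i → g i (tabulate λ l → x l j)))
      ≡⟨ f⟂h (λ i j → g i (tabulate λ l → x l j)) ⟩
    f (tabulate λ i → h (tabulate λ j → g i (tabulate λ l → x l j)))
      ≡⟨ cong f (tabulate-cong λ i → g⟂h i x) ⟩
    f (tabulate λ i → g i (tabulate λ l → h (tabulate λ j → x l j))) ∎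

  ⟂-isClone : (F : OpSet A ℓ) → IsClone (F ^⟂)
  ⟂-isClone F = record
    { resp = λ f≗g f∈F⟂ m h h∈F → ⟂-respˡ {h = h} f≗g (f∈F⟂ m h h∈F)
    ; proj = λ i m h h∈F → π-⟂ i h
    ; comp = λ {_} {_} {f} {g} f∈F⟂ g∈F⟂ m h h∈F →
        compose-⟂ {f = f} {g} {h} (f∈F⟂ m h h∈F) (λ i → g∈F⟂ i m h h∈F)
    }

  -- Every centralizer is a clone, and `F ^⟂⟂` is one that contains `F` because commutation is
  -- symmetric.
  ⟨⟩⊆⟂⟂ : {F : OpSet A ℓ} → ∀ n {f : Op A n} → ⟨ F ⟩ n f → (F ^⟂⟂) n f
  ⟨⟩⊆⟂⟂ {F = F} n = ⟨⟩-least (⟂-isClone (F ^⟂)) ⊆-⟂⟂ n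

  module Enumeration (A-finite : Finite (setoid A)) where
    private
      N = proj₁ A-finite
      module I = Inverse (proj₂ A-finite)

    infix 4 _≟_
    _≟_ : DecidableEquality A
    _≟_ = inj⇒≟ (Inverse⇒Injection (proj₂ A-finite))

    tuple : ∀ {n} → Fin (N ^ n) → Vec A n
    tuple k = tabulate (I.from ∘ finToFun k)

    index : ∀ {n} → Vec A n → Fin (N ^ n)
    index v = funToFin (I.to ∘ lookup v)

    -- Every argument tuple is thus enumerated, so a value table determines its operation.
    tuple-index : ∀ {n} (v : Vec A n) → tuple (index v) ≡ v
    tuple-index v = begin
      tabulate (I.from ∘ finToFun (index v))
        ≡⟨ tabulate-cong (λ i → I.inverseʳ (finToFun-funToFin (I.to ∘ lookup v) i)) ⟩
      tabulate (lookup v)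
        ≡⟨ tabulate∘lookup v ⟩
      v ∎

-- Free actions and equivariant operations

module _ {G : Group c ℓ} (A : FreeGSet G a) where
  open FreeGSet A
  private module G = Group G

  ⁻¹-· : ∀ γ x → γ G.⁻¹ · (γ · x) ≡ x
  ⁻¹-· γ x = begin
    γ G.⁻¹ · (γ · x)    ≡⟨ ·-assoc (γ G.⁻¹) γ x ⟨
    (γ G.⁻¹ G.∙ γ) · x  ≡⟨ ·-congʳ x (G.inverseˡ γ) ⟩
    G.ε · x             ≡⟨ ·-unit x ⟩
    x                   ∎

  -- The element `γ G.∙ δ G.⁻¹` fixes `δ · x`, so freeness applies.
  ·-cancelʳ : ∀ γ δ x → γ · x ≡ δ · x → γ G.≈ δ
  ·-cancelʳ γ δ x γx≡δx = x∙y⁻¹≈ε⇒x≈y G γ δ (free (γ G.∙ δ G.⁻¹) (δ · x) (begin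
    (γ G.∙ δ G.⁻¹) · (δ · x)  ≡⟨ ·-assoc γ (δ G.⁻¹) (δ · x) ⟩
    γ · (δ G.⁻¹ · (δ · x))    ≡⟨ cong (γ ·_) (⁻¹-· δ x) ⟩
    γ · x                     ≡⟨ γx≡δx ⟩
    δ · x                     ∎))

  infixr 7 _·ᵛ_
  _·ᵛ_ : ∀ {n} → G.Carrier → Vec Carrier n → Vec Carrier n
  γ ·ᵛ v = map (γ ·_) v

  ·ᵛ-assoc : ∀ {n} γ δ (v : Vec Carrier n) → (γ G.∙ δ) ·ᵛ v ≡ γ ·ᵛ δ ·ᵛ v
  ·ᵛ-assoc γ δ v = trans (map-cong (·-assoc γ δ) v) (map-∘ (γ ·_) (δ ·_) v)

  ⁻¹-·ᵛ : ∀ {n} γ (v : Vec Carrier n) → γ G.⁻¹ ·ᵛ γ ·ᵛ v ≡ v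
  ⁻¹-·ᵛ γ v = begin
    γ G.⁻¹ ·ᵛ γ ·ᵛ v              ≡⟨ map-∘ (γ G.⁻¹ ·_) (γ ·_) v ⟨
    map (λ x → γ G.⁻¹ · γ · x) v  ≡⟨ map-cong (⁻¹-· γ) v ⟩
    map (λ x → x) v               ≡⟨ map-id v ⟩
    v                             ∎

  Equivariant : ∀ {n} → Op Carrier n → Set _
  Equivariant g = ∀ γ v → g (γ ·ᵛ v) ≡ γ · g v

  -- This supplies the test operations against which members of the double centralizer are checked.
  equivariant⇒⟂ : ∀ {m} {g : Op Carrier m} → Equivariant g → (BasicOp A ^⟂) m g
  equivariant⇒⟂ {g = g} g-eqv _ h (basic γ h≗γ) x = begin
    h (g (tabulate λ i → x i zero) ∷ [])
      ≡⟨ h≗γ _ ⟩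
    γ · g (tabulate λ i → x i zero)
      ≡⟨ g-eqv γ _ ⟨
    g (γ ·ᵛ tabulate λ i → x i zero)
      ≡⟨ cong g (tabulate-∘ (γ ·_) (λ i → x i zero)) ⟨
    g (tabulate λ i → γ · x i zero)
      ≡⟨ cong g (tabulate-cong λ i → h≗γ (x i zero)) ⟨
    g (tabulate λ i → h (x i zero ∷ [])) ∎

  translate∈⟨⟩ : ∀ {n} {f : Op Carrier n} γ i →
                 (∀ v → f v ≡ γ · lookup v i) → ⟨ BasicOp A ⟩ n f
  translate∈⟨⟩ γ i f≗γπᵢ =
    resp (sym ∘ f≗γπᵢ)
         (comp (incl (basic γ {f = λ v → γ · head v} λ _ → refl)) λ _ → proj i)

  InOrbit : ∀ {n} → Vec Carrier n → Vec Carrier n → Set _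
  InOrbit t v = ∃ λ γ → v ≡ γ ·ᵛ t

  -- Read contrapositively: the complement of an orbit is stable under `G`, so an equivariant map
  -- can be defined separately on the two pieces.
  InOrbit-cancel : ∀ {n} {t v : Vec Carrier n} γ → InOrbit t (γ ·ᵛ v) → InOrbit t v
  InOrbit-cancel {t = t} {v} γ (δ , γv≡δt) = γ G.⁻¹ G.∙ δ , (begin
    v                     ≡⟨ ⁻¹-·ᵛ γ v ⟨
    γ G.⁻¹ ·ᵛ γ ·ᵛ v      ≡⟨ cong (γ G.⁻¹ ·ᵛ_) γv≡δt ⟩
    γ G.⁻¹ ·ᵛ δ ·ᵛ t      ≡⟨ ·ᵛ-assoc (γ G.⁻¹) δ t ⟨
    (γ G.⁻¹ G.∙ δ) ·ᵛ t   ∎)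

  module _ (G-finite : Finite G.setoid) where
    private module GI = Inverse (proj₂ G-finite)

    inOrbit? : DecidableEquality Carrier →
               ∀ {n} (t v : Vec Carrier n) → Dec (InOrbit t v)
    inOrbit? _≟_ t v = map′
      (λ (j , v≡γt) → GI.from j , v≡γt)
      (λ (γ , v≡γt) → GI.to γ , trans v≡γt
        (map-cong (λ x → ·-congʳ x (G.sym (GI.strictlyInverseʳ γ))) t))
      (any? λ j → ≡-dec _≟_ v (GI.from j ·ᵛ t))

  module Prescribe {m} (t : Vec Carrier m) (inOrbit? : ∀ v → Dec (InOrbit t v))
                   (k : Fin m) (p : Carrier) where

    -- The value `p` at `t` extends equivariantly along its orbit; elsewhere the projection to
    -- coordinate `k` serves as an equivariant default.
    prescribe : Op Carrier m
    prescribe v with inOrbit? v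
    ... | yes (γ , _) = γ · p
    ... | no  _       = lookup v k

    prescribe-on : ∀ γ {v} → v ≡ γ ·ᵛ t → prescribe v ≡ γ · p
    prescribe-on γ {v} v≡γt with inOrbit? v
    ... | no  v∉          = contradiction (γ , v≡γt) v∉
    -- The `δ` found by `inOrbit?` need not be the given `γ` syntactically; comparing coordinate `k`
    -- of `δ ·ᵛ t` and `γ ·ᵛ t` identifies them by freeness.
    ... | yes (δ , v≡δt)  = ·-congʳ p (·-cancelʳ δ γ (lookup t k) (begin
      δ · lookup t k        ≡⟨ lookup-map k (δ ·_) t ⟨
      lookup (δ ·ᵛ t) k     ≡⟨ cong (λ w → lookup w k) (trans (sym v≡δt) v≡γt) ⟩
      lookup (γ ·ᵛ t) k     ≡⟨ lookup-map k (γ ·_) t ⟩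
      γ · lookup t k        ∎))

    prescribe-off : ∀ {v} → ¬ InOrbit t v → prescribe v ≡ lookup v k
    prescribe-off {v} v∉ with inOrbit? v
    ... | yes v∈ = contradiction v∈ v∉
    ... | no  _  = refl

    prescribe-equivariant : Equivariant prescribe
    prescribe-equivariant γ v with inOrbit? v
    ... | yes (δ , v≡δt) = trans
      (prescribe-on (γ G.∙ δ) (trans (cong (γ ·ᵛ_) v≡δt) (sym (·ᵛ-assoc γ δ t))))
      (·-assoc γ δ p)
    ... | no v∉ = trans (prescribe-off (v∉ ∘ InOrbit-cancel γ)) (lookup-map k (γ ·_) v)

    prescribe-self : prescribe t ≡ p
    prescribe-self = trans
      (prescribe-on G.ε (sym (trans (map-cong ·-unit t) (map-id t)))) (·-unit p)

  -- Value tables and the double centralizer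

  module _ (G-finite : Finite G.setoid) (A-finite : Finite (setoid Carrier)) where
    open Enumeration A-finite

    table : ∀ {n} → Op Carrier n → Vec Carrier _
    table f = tabulate (f ∘ tuple)

    lookup-table : ∀ {n} (f : Op Carrier n) v → lookup (table f) (index v) ≡ f v
    lookup-table f v = trans (lookup∘tabulate (f ∘ tuple) (index v))
                             (cong f (tuple-index v))

    ⟂⟂⇒table : ∀ {n} {f : Op Carrier n} → (BasicOp A ^⟂⟂) n f →
               ∀ g → Equivariant g → g (table f) ≡ f (tabulate λ i → g (table (π i)))
    ⟂⟂⇒table {f = f} f∈ g g-eqv = begin
      g (table f)
        ≡⟨ cong g (tabulate-cong λ j → cong f (tabulate∘lookup (tuple j))) ⟨
      g (tabulate λ j → f (tabulate λ i → lookup (tuple j) i))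
        ≡⟨ f∈ _ g (equivariant⇒⟂ g-eqv) (λ i j → lookup (tuple j) i) ⟩
      f (tabulate λ i → g (table (π i))) ∎

    ⟂⟂⇒inOrbit : (∃₂ λ (x y : Carrier) → x ≢ y) →
                 ∀ {n} {f : Op Carrier n} → (BasicOp A ^⟂⟂) n f →
                 ∃ λ i → InOrbit (table f) (table (π i))
    ⟂⟂⇒inOrbit (x , y , x≢y) {n} {f} f∈
      with any? (λ i → inOrbit? G-finite _≟_ (table f) (table (π i)))
    ... | yes i∈ = i∈
    -- For `n` equal to 0 only this case arises, so the double centralizer has no nullary operation.
    ... | no  ∉  = contradiction (trans (value x) (sym (value y))) x≢y
      where
      -- A tuple fixed independently of `p`. With `index v` as default coordinate, `prescribe` sends
      -- the table of `π i` to `lookup v i`, so `p` disappears from the right-hand side of `value`.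
      v = replicate n x

      value : ∀ p → p ≡ f (tabulate (lookup v))
      value p = begin
        p
          ≡⟨ prescribe-self ⟨
        prescribe (table f)
          ≡⟨ ⟂⟂⇒table {f = f} f∈ prescribe prescribe-equivariant ⟩
        f (tabulate λ i → prescribe (table (π i)))
          ≡⟨ cong f (tabulate-cong λ i →
               trans (prescribe-off (∉ ∘ (i ,_))) (lookup-table (π i) v)) ⟩
        f (tabulate (lookup v)) ∎
        where open Prescribe (table f) (inOrbit? G-finite _≟_ (table f)) (index v) p

    ⟂⟂⊆⟨⟩ : (∃₂ λ (x y : Carrier) → x ≢ y) →
            ∀ n {f : Op Carrier n} → (BasicOp A ^⟂⟂) n f → ⟨ BasicOp A ⟩ n f
    ⟂⟂⊆⟨⟩ x≢y n {f} f∈ with ⟂⟂⇒inOrbit x≢y {f = f} f∈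
    -- The table of `π i` is `γ` times that of `f`, hence the inverse; reading entry `index v` turns
    -- this into an equation at `v`.
    ... | i , γ , πᵢ≡γf = translate∈⟨⟩ (γ G.⁻¹) i λ v → begin
      f v
        ≡⟨ ⁻¹-· γ (f v) ⟨
      γ G.⁻¹ · γ · f v
        ≡⟨ cong (λ z → γ G.⁻¹ · γ · z) (lookup-table f v) ⟨
      γ G.⁻¹ · γ · lookup (table f) (index v)
        ≡⟨ cong (γ G.⁻¹ ·_) (lookup-map (index v) (γ ·_) (table f)) ⟨
      γ G.⁻¹ · lookup (γ ·ᵛ table f) (index v)
        ≡⟨ cong (λ w → γ G.⁻¹ · lookup w (index v)) πᵢ≡γf ⟨
      γ G.⁻¹ · lookup (table (π i)) (index v)
        ≡⟨ cong (γ G.⁻¹ ·_) (lookup-table (π i) v) ⟩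
      γ G.⁻¹ · lookup v i ∎

theorem8p2 : {c ℓ a : Level} (G : Group c ℓ) → Finite (Group.setoid G) →
    (A : FreeGSet G a) → Finite (setoid (FreeGSet.Carrier A)) →
    (∃₂ λ (x y : FreeGSet.Carrier A) → x ≢ y) →
    ∀ n → (BasicOp A ^⟂⟂) n ≐ ⟨ BasicOp A ⟩ n
theorem8p2 G G-finite A A-finite x≢y n =
  (λ {f} → ⟂⟂⊆⟨⟩ A G-finite A-finite x≢y n {f}) , ⟨⟩⊆⟂⟂ n
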